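{- Let $x$ be a complex number and $n\ge 2$ an integer such that all quantities below are defined. Then \[ \sum_{k=0}^n\binom{2n-k}{n}\binom{x+k}{k}k^2H_{k}^{\langle2\rangle}(x)=\frac{(x+1)(xn+3n+1)}{8(n-1)}\binom{x+2n+1}{n-2} \Big\{4H_{2n+1}^{\langle2\rangle}(x)+\tfrac{8(x^2+3x+n^2-n+1)}{n(x+1)(xn+3n+1)} -\big[H_n(\tfrac{x}{2})-H_{n+1}(\tfrac{x-1}{2})\big] \big[H_n(\tfrac{x}{2})-H_{n+1}(\tfrac{x-1}{2})-\tfrac{4(x+n+1)(x^2+3x-2n+1)}{n(x+1)(xn+3n+1)}\big]\Big\}. \]
   Context: For a complex $y$ and an integer $k\ge 0$, $\binom{y}{k}=\frac{y(y-1)\cdots(y-k+1)}{k!}$. For complex $x$, integer $n\ge 0$ and positive integer $\ell$: $H_0^{\langle\ell\rangle}(x)=0$, $H_n^{\langle\ell\rangle}(x)=\sum_{k=1}^n\frac{1}{(x+k)^\ell}$, and $H_n(x)=H_n^{\langle1\rangle}(x)$. -}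

module Defs where

open import Level using (Level; _⊔_) renaming (suc to lsuc)
open import Algebra.Bundles using (CommutativeRing)
open import Data.Nat as ℕ using (ℕ; zero; suc)
open import Data.Nat.Base using (_!)

natCast : ∀ {c ℓ} (R : CommutativeRing c ℓ) → ℕ → CommutativeRing.Carrier R
natCast R zero    = CommutativeRing.0# R
natCast R (suc n) = CommutativeRing._+_ R (CommutativeRing.1# R) (natCast R n)
open import Relation.Nullary using (¬_)

-- A field of characteristic 0 (ℂ is an instance).  The inverse is a total
-- operation; it is only constrained on nonzero elements (the value at 0 is
-- irrelevant since the theorem assumes every denominator is nonzero).
record Char0Field (c ℓ : Level) : Set (lsuc (c ⊔ ℓ)) where
  field
    commutativeRing : CommutativeRing c ℓ
  open CommutativeRing commutativeRing public
  field
    _⁻¹      : Carrier → Carrier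
    ⁻¹-cong  : ∀ {x y} → x ≈ y → (x ⁻¹) ≈ (y ⁻¹)
    inverseʳ : ∀ x → ¬ (x ≈ 0#) → (x * (x ⁻¹)) ≈ 1#
    char0    : ∀ n → ¬ (natCast commutativeRing (suc n) ≈ 0#)

  ι : ℕ → Carrier
  ι = natCast commutativeRing

module FieldOps {c ℓ} (F : Char0Field c ℓ) where
  open Char0Field F

  infixl 7 _/_
  _/_ : Carrier → Carrier → Carrier
  x / y = x * (y ⁻¹)

  pow : Carrier → ℕ → Carrier
  pow x zero    = 1#
  pow x (suc k) = x * pow x k

  falling : Carrier → ℕ → Carrier
  falling y zero    = 1#
  falling y (suc k) = falling y k * (y - ι k)

  binom : Carrier → ℕ → Carrier
  binom y k = falling y k / ι (k !)

  Σ₁ : ℕ → (ℕ → Carrier) → Carrier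
  Σ₁ zero    f = 0#
  Σ₁ (suc n) f = Σ₁ n f + f (suc n)

  Σ₀ : ℕ → (ℕ → Carrier) → Carrier
  Σ₀ n f = f 0 + Σ₁ n f

  Hˡ : ℕ → ℕ → Carrier → Carrier
  Hˡ l n x = Σ₁ n (λ k → 1# / pow (x + ι k) l)

  H : ℕ → Carrier → Carrier
  H n x = Hˡ 1 n x

{-# OPTIONS --safe #-}
module Submission where

open import Defs
open import Algebra.Bundles using (CommutativeRing)
open import Data.Nat as ℕ using (ℕ; zero; suc; _∸_)
open import Data.Nat.Base using (_!)
import Data.Nat.Properties as ℕ
open import Data.Integer as ℤ using (ℤ; +_; -[1+_]; _⊖_)
import Data.Integer.Properties as ℤ
open import Data.Maybe using (Maybe; just; nothing)
open import Relation.Nullary using (¬_; yes; no)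
open import Relation.Binary.PropositionalEquality as ≡ using (_≡_)

-- Put u = y² and let P(y) = ∏ (x + j + (-1)^j y), 1 ≤ j ≤ 2n+1, with even and odd
-- parts E(u) and y O(u).  In the basis Q_k(u) = ∏ ((x+i)² - u), 1 ≤ i ≤ k, both have
-- hypergeometric coefficients,
--   E = Σ A_k (x+k+1)⋯(x+n+1) Q_k,   -O = Σ A_k (x+k+2)⋯(x+n+1) Q_k,
-- where A_k = n! C(2n-k, n) / k!; this follows from the recurrences
-- E' = (C - u) E + u O and O' = (C - u) O + E for the passage from n to n+1, where
-- C = (x+2n+2)(x+2n+3).  Multiplication by u acts on the Q_k by a two-term rule,
-- so summation by parts expresses the moments Σ k A_k ⋯ Q_k and Σ k² A_k ⋯ Q_k
-- through E and O.  The coefficient of u in Q_k is -(x+1)_k² H_k^{⟨2⟩}(x), and those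
-- in E and O are elementary symmetric functions of the (-1)^j / (x+j), which
-- produces both H_{2n+1}^{⟨2⟩}(x) and the square of the difference of harmonic numbers.
--
-- Only the coefficients of 1 and u matter.  After division of Q_k by (x+1)_k and of
-- E and O by (x+1)_{n+1}, q is such a coefficient of Q_k and t that of u Q_k / (x+k+1);
-- W and -V are the values of E and O at u = 0, and -U is the coefficient of u in E.

-- Ring solver with integer coefficients.

module IntegerCoefficientSolver {c ℓ} (R : CommutativeRing c ℓ) where
  open CommutativeRing R
  open import Algebra.Properties.Ring ring
    using (-‿distribˡ-*; -‿distribʳ-*; -0#≈0#; -‿involutive; -‿+-comm)
  open import Algebra.Solver.Ring.AlmostCommutativeRing
    using (fromCommutativeRing; _-Raw-AlmostCommutative⟶_)
  open import Relation.Binary.Reasoning.Setoid setoid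

  private
    ι : ℕ → Carrier
    ι = natCast R

    -- Nonnegative integers go to `ι` on the nose, so that numerals in goals are matched by `:ι`
    -- without conversion.
    fromℤ : ℤ → Carrier
    fromℤ (+ n)    = ι n
    fromℤ -[1+ n ] = - ι (suc n)

  natCast-+ : ∀ m n → ι (m ℕ.+ n) ≈ ι m + ι n
  natCast-+ zero    n = sym (+-identityˡ _)
  natCast-+ (suc m) n = trans (+-congˡ (natCast-+ m n)) (sym (+-assoc _ _ _))

  natCast-* : ∀ m n → ι (m ℕ.* n) ≈ ι m * ι n
  natCast-* zero    n = sym (zeroˡ _)
  natCast-* (suc m) n = begin
    ι (n ℕ.+ m ℕ.* n)     ≈⟨ natCast-+ n (m ℕ.* n) ⟩
    ι n + ι (m ℕ.* n)     ≈⟨ +-cong (sym (*-identityˡ _)) (natCast-* m n) ⟩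
    1# * ι n + ι m * ι n  ≈⟨ distribʳ _ _ _ ⟨
    (1# + ι m) * ι n      ∎

  private
    fromℤ-⊖ : ∀ m n → fromℤ (m ⊖ n) ≈ ι m - ι n
    fromℤ-⊖ zero    zero    = sym (-‿inverseʳ _)
    fromℤ-⊖ (suc m) zero    = sym (trans (+-congˡ -0#≈0#) (+-identityʳ _))
    fromℤ-⊖ zero    (suc n) = sym (+-identityˡ _)
    fromℤ-⊖ (suc m) (suc n) = begin
      fromℤ (suc m ⊖ suc n)            ≡⟨ ≡.cong fromℤ (ℤ.[1+m]⊖[1+n]≡m⊖n m n) ⟩
      fromℤ (m ⊖ n)                    ≈⟨ fromℤ-⊖ m n ⟩
      ι m - ι n                        ≈⟨ +-congʳ (+-identityʳ _) ⟨
      ι m + 0# - ι n                   ≈⟨ +-congʳ (+-congˡ (-‿inverseʳ 1#)) ⟨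
      ι m + (1# - 1#) - ι n            ≈⟨ +-congʳ (+-assoc _ _ _) ⟨
      ι m + 1# - 1# - ι n              ≈⟨ +-assoc _ _ _ ⟩
      ι m + 1# + (- 1# - ι n)          ≈⟨ +-cong (+-comm _ _) (-‿+-comm _ _) ⟩
      1# + ι m - (1# + ι n)            ∎

    fromℤ-neg : ∀ i → fromℤ (ℤ.- i) ≈ - fromℤ i
    fromℤ-neg (+ zero)  = sym -0#≈0#
    fromℤ-neg (+ suc n) = refl
    fromℤ-neg -[1+ n ]  = sym (-‿involutive _)

    fromℤ-+ : ∀ i j → fromℤ (i ℤ.+ j) ≈ fromℤ i + fromℤ j
    fromℤ-+ (+ m)    (+ n)    = natCast-+ m n
    fromℤ-+ (+ m)    -[1+ n ] = fromℤ-⊖ m (suc n)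
    fromℤ-+ -[1+ m ] (+ n)    = trans (fromℤ-⊖ n (suc m)) (+-comm _ _)
    fromℤ-+ -[1+ m ] -[1+ n ] = begin
      - ι (suc (suc (m ℕ.+ n)))  ≡⟨ ≡.cong (λ k → - ι (suc k)) (ℕ.+-suc m n) ⟨
      - ι (suc m ℕ.+ suc n)      ≈⟨ -‿cong (natCast-+ (suc m) (suc n)) ⟩
      - (ι (suc m) + ι (suc n))  ≈⟨ -‿+-comm _ _ ⟨
      - ι (suc m) - ι (suc n)    ∎

    fromℤ-* : ∀ i j → fromℤ (i ℤ.* j) ≈ fromℤ i * fromℤ j
    fromℤ-* (+ m) (+ n) = begin
      fromℤ (+ m ℤ.* + n)  ≡⟨ ≡.cong fromℤ (ℤ.+◃n≡+n (m ℕ.* n)) ⟩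
      ι (m ℕ.* n)          ≈⟨ natCast-* m n ⟩
      ι m * ι n            ∎
    fromℤ-* (+ m) -[1+ n ] = begin
      fromℤ (+ m ℤ.* -[1+ n ])     ≡⟨ ≡.cong fromℤ (ℤ.-◃n≡-n (m ℕ.* suc n)) ⟩
      fromℤ (ℤ.- (+ (m ℕ.* suc n))) ≈⟨ fromℤ-neg (+ (m ℕ.* suc n)) ⟩
      - ι (m ℕ.* suc n)            ≈⟨ -‿cong (natCast-* m (suc n)) ⟩
      - (ι m * ι (suc n))          ≈⟨ -‿distribʳ-* _ _ ⟩
      ι m * - ι (suc n)            ∎
    fromℤ-* -[1+ m ] (+ n) = begin
      fromℤ (-[1+ m ] ℤ.* + n)     ≡⟨ ≡.cong fromℤ (ℤ.-◃n≡-n (suc m ℕ.* n)) ⟩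
      fromℤ (ℤ.- (+ (suc m ℕ.* n))) ≈⟨ fromℤ-neg (+ (suc m ℕ.* n)) ⟩
      - ι (suc m ℕ.* n)            ≈⟨ -‿cong (natCast-* (suc m) n) ⟩
      - (ι (suc m) * ι n)          ≈⟨ -‿distribˡ-* _ _ ⟩
      - ι (suc m) * ι n            ∎
    fromℤ-* -[1+ m ] -[1+ n ] = begin
      ι (suc m ℕ.* suc n)          ≈⟨ natCast-* (suc m) (suc n) ⟩
      ι (suc m) * ι (suc n)        ≈⟨ -‿involutive _ ⟨
      - - (ι (suc m) * ι (suc n))  ≈⟨ -‿cong (-‿distribʳ-* _ _) ⟩
      - (ι (suc m) * - ι (suc n))  ≈⟨ -‿distribˡ-* _ _ ⟩
      - ι (suc m) * - ι (suc n)    ∎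

    morphism : ℤ.+-*-rawRing -Raw-AlmostCommutative⟶ fromCommutativeRing R
    morphism = record
      { ⟦_⟧    = fromℤ
      ; +-homo = fromℤ-+
      ; *-homo = fromℤ-*
      ; -‿homo = fromℤ-neg
      ; 0-homo = refl
      ; 1-homo = +-identityʳ 1#
      }

    -- A sufficient test only: distinct integers may have the same image in `R`, and the solver
    -- merely misses such coincidences.
    _≟_ : ∀ i j → Maybe (fromℤ i ≈ fromℤ j)
    i ≟ j with i ℤ.≟ j
    ... | yes ≡.refl = just refl
    ... | no  _      = nothing

  open import Algebra.Solver.Ring ℤ.+-*-rawRing (fromCommutativeRing R) morphism _≟_ public
    using (Polynomial; solve; _:=_; _:+_; _:*_; _:-_; :-_; _:^_; con)

  :ι : ∀ {m} → ℕ → Polynomial m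
  :ι n = con (+ n)

  -- The constant :ι 1 denotes 1# + 0#, whereas :1 denotes 1# on the nose.
  :1 : ∀ {m} → Polynomial m
  :1 = :ι 0 :^ 0

-- Inverses, falling factorials and finite sums.

module FieldLemmas {c ℓ} (F : Char0Field c ℓ) where
  open Char0Field F
  open FieldOps F
  open IntegerCoefficientSolver commutativeRing
  open import Relation.Binary.Reasoning.Setoid setoid

  ι-+ : ∀ m n → ι (m ℕ.+ n) ≈ ι m + ι n
  ι-+ = natCast-+

  -- Uses of this lemma leave a polynomial identity to the ring solver, once
  -- every relation has been scaled by its cofactor with *-congˡ.
  modulo : ∀ {a b l r} → l ≈ r → a + r ≈ b + l → a ≈ b
  modulo {a} {b} {l} {r} l≈r eq = begin
    a          ≈⟨ solve 2 (λ a r → a := a :+ r :- r) refl a r ⟩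
    a + r - r  ≈⟨ +-congʳ eq ⟩
    b + l - r  ≈⟨ +-congʳ (+-congˡ l≈r) ⟩
    b + r - r  ≈⟨ solve 2 (λ a r → a :+ r :- r := a) refl b r ⟩
    b          ∎

  ι≉0 : ∀ n .{{_ : ℕ.NonZero n}} → ¬ (ι n ≈ 0#)
  ι≉0 (suc n) = char0 n

  inverseˡ : ∀ a → ¬ (a ≈ 0#) → a ⁻¹ * a ≈ 1#
  inverseˡ a a≉0 = trans (*-comm _ _) (inverseʳ a a≉0)

  *-cancelˡ-≉0 : ∀ {a b c} → ¬ (a ≈ 0#) → a * b ≈ a * c → b ≈ c
  *-cancelˡ-≉0 {a} {b} {c} a≉0 eq = begin
    b               ≈⟨ *-identityˡ _ ⟨
    1# * b          ≈⟨ *-congʳ (inverseˡ a a≉0) ⟨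
    a ⁻¹ * a * b    ≈⟨ *-assoc _ _ _ ⟩
    a ⁻¹ * (a * b)  ≈⟨ *-congˡ eq ⟩
    a ⁻¹ * (a * c)  ≈⟨ *-assoc _ _ _ ⟨
    a ⁻¹ * a * c    ≈⟨ *-congʳ (inverseˡ a a≉0) ⟩
    1# * c          ≈⟨ *-identityˡ _ ⟩
    c               ∎

  *-≉0 : ∀ {a b} → ¬ (a ≈ 0#) → ¬ (b ≈ 0#) → ¬ (a * b ≈ 0#)
  *-≉0 a≉0 b≉0 ab≈0 = b≉0 (*-cancelˡ-≉0 a≉0 (trans ab≈0 (sym (zeroʳ _))))

  1≉0 : ¬ (1# ≈ 0#)
  1≉0 1≈0 = char0 0 (trans (+-identityʳ _) 1≈0)

  -- A product equal to 1 forces `a` to be nonzero, because 1 = 0 contradicts characteristic 0; so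
  -- an inverse is identified by a single multiplication.
  ⁻¹-unique : ∀ {a b} → a * b ≈ 1# → b ≈ a ⁻¹
  ⁻¹-unique {a} {b} ab≈1 = *-cancelˡ-≉0 a≉0 (trans ab≈1 (sym (inverseʳ a a≉0)))
    where
    a≉0 : ¬ (a ≈ 0#)
    a≉0 a≈0 = 1≉0 (trans (sym ab≈1) (trans (*-congʳ a≈0) (zeroˡ b)))

  1/pow1 : ∀ a → 1# / pow a 1 ≈ a ⁻¹
  1/pow1 a = trans (*-identityˡ _) (⁻¹-cong (*-identityʳ a))

  1/pow2 : ∀ a → ¬ (a ≈ 0#) → 1# / pow a 2 ≈ a ⁻¹ * a ⁻¹
  1/pow2 a a≉0 = trans (*-identityˡ _) (sym (⁻¹-unique (begin
    pow a 2 * (a ⁻¹ * a ⁻¹)      ≈⟨ solve 2 (λ a i → a :* (a :* :1) :* (i :* i) := (a :* i) :* (a :* i)) refl a (a ⁻¹) ⟩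
    (a * a ⁻¹) * (a * a ⁻¹)      ≈⟨ *-cong (inverseʳ a a≉0) (inverseʳ a a≉0) ⟩
    1# * 1#                      ≈⟨ *-identityˡ _ ⟩
    1#                           ∎)))

  falling-cong : ∀ {y y′} k → y ≈ y′ → falling y k ≈ falling y′ k
  falling-cong zero    _  = refl
  falling-cong (suc k) eq = *-cong (falling-cong k eq) (+-congʳ eq)

  -- The definition of `falling` splits off the smallest factor, this the largest. Playing the two
  -- against each other yields `A-rel` and `A-suc`.
  falling-top : ∀ y k → falling (1# + y) (suc k) ≈ (1# + y) * falling y k
  falling-top y zero    = solve 1 (λ y → :1 :* (:1 :+ y :- :ι 0) := (:1 :+ y) :* :1) refl y
  falling-top y (suc k) = begin
    falling (1# + y) (suc k) * (1# + y - (1# + ι k))  ≈⟨ *-congʳ (falling-top y k) ⟩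
    (1# + y) * falling y k * (1# + y - (1# + ι k))
      ≈⟨ solve 3 (λ y f k → (:1 :+ y) :* f :* (:1 :+ y :- (:1 :+ k)) := (:1 :+ y) :* (f :* (y :- k))) refl y (falling y k) (ι k) ⟩
    (1# + y) * (falling y k * (y - ι k))              ∎

  Σ₀-cong : ∀ n {f g} → (∀ k → k ℕ.≤ n → f k ≈ g k) → Σ₀ n f ≈ Σ₀ n g
  Σ₀-cong n {f} {g} eq = +-cong (eq 0 ℕ.z≤n) (Σ₁-cong n ℕ.≤-refl)
    where
    Σ₁-cong : ∀ m → m ℕ.≤ n → Σ₁ m f ≈ Σ₁ m g
    Σ₁-cong zero    _   = refl
    Σ₁-cong (suc m) m<n = +-cong (Σ₁-cong m (ℕ.<⇒≤ m<n)) (eq (suc m) m<n)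

  Σ₀-suc : ∀ n f → Σ₀ (suc n) f ≈ Σ₀ n f + f (suc n)
  Σ₀-suc n f = sym (+-assoc _ _ _)

  Σ₀-+ : ∀ n f g → Σ₀ n (λ k → f k + g k) ≈ Σ₀ n f + Σ₀ n g
  Σ₀-+ zero    f g = solve 2 (λ a b → a :+ b :+ :ι 0 := a :+ :ι 0 :+ (b :+ :ι 0)) refl (f 0) (g 0)
  Σ₀-+ (suc n) f g = begin
    Σ₀ (suc n) (λ k → f k + g k)                 ≈⟨ Σ₀-suc n _ ⟩
    Σ₀ n (λ k → f k + g k) + (f (suc n) + g (suc n))  ≈⟨ +-congʳ (Σ₀-+ n f g) ⟩
    Σ₀ n f + Σ₀ n g + (f (suc n) + g (suc n))
      ≈⟨ solve 4 (λ a b c d → a :+ b :+ (c :+ d) := a :+ c :+ (b :+ d)) refl _ _ _ _ ⟩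
    Σ₀ n f + f (suc n) + (Σ₀ n g + g (suc n))    ≈⟨ +-cong (Σ₀-suc n f) (Σ₀-suc n g) ⟨
    Σ₀ (suc n) f + Σ₀ (suc n) g                  ∎

  Σ₀-* : ∀ n a f → Σ₀ n (λ k → a * f k) ≈ a * Σ₀ n f
  Σ₀-* zero    a f = solve 2 (λ a b → a :* b :+ :ι 0 := a :* (b :+ :ι 0)) refl a (f 0)
  Σ₀-* (suc n) a f = begin
    Σ₀ (suc n) (λ k → a * f k)            ≈⟨ Σ₀-suc n _ ⟩
    Σ₀ n (λ k → a * f k) + a * f (suc n)  ≈⟨ +-congʳ (Σ₀-* n a f) ⟩
    a * Σ₀ n f + a * f (suc n)            ≈⟨ distribˡ _ _ _ ⟨
    a * (Σ₀ n f + f (suc n))              ≈⟨ *-congˡ (Σ₀-suc n f) ⟨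
    a * Σ₀ (suc n) f                      ∎

  -- Every summation by parts below exhibits a certificate `G` with f k - g k = G k - G (k+1). The
  -- upper boundary term is kept, since it is either zero or the extra summand of a longer sum.
  Σ₀-telescope : ∀ n (f g G : ℕ → Carrier) → G 0 ≈ 0# →
    (∀ k → k ℕ.≤ n → f k + G (suc k) ≈ g k + G k) →
    Σ₀ n f + G (suc n) ≈ Σ₀ n g
  Σ₀-telescope zero f g G G0≈0 eq = begin
    f 0 + 0# + G 1  ≈⟨ +-congʳ (+-identityʳ _) ⟩
    f 0 + G 1       ≈⟨ eq 0 ℕ.z≤n ⟩
    g 0 + G 0       ≈⟨ +-congˡ G0≈0 ⟩
    g 0 + 0#        ∎
  Σ₀-telescope (suc n) f g G G0≈0 eq = begin
    Σ₀ (suc n) f + G (suc (suc n))              ≈⟨ +-congʳ (Σ₀-suc n f) ⟩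
    Σ₀ n f + f (suc n) + G (suc (suc n))        ≈⟨ +-assoc _ _ _ ⟩
    Σ₀ n f + (f (suc n) + G (suc (suc n)))      ≈⟨ +-congˡ (eq (suc n) ℕ.≤-refl) ⟩
    Σ₀ n f + (g (suc n) + G (suc n))
      ≈⟨ solve 3 (λ a b c → a :+ (b :+ c) := a :+ c :+ b) refl _ _ _ ⟩
    Σ₀ n f + G (suc n) + g (suc n)
      ≈⟨ +-congʳ (Σ₀-telescope n f g G G0≈0 (λ k k≤n → eq k (ℕ.m≤n⇒m≤1+n k≤n))) ⟩
    Σ₀ n g + g (suc n)                          ≈⟨ Σ₀-suc n g ⟨
    Σ₀ (suc n) g                                ∎

-- Hypergeometric recurrences of the coefficients A_k.

module Coefficients {c ℓ} (F : Char0Field c ℓ) where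
  open Char0Field F
  open FieldOps F
  open FieldLemmas F
  open IntegerCoefficientSolver commutativeRing
  open import Relation.Binary.Reasoning.Setoid setoid

  1/_! : ℕ → Carrier
  1/ k ! = ι (k !) ⁻¹

  1/!-suc : ∀ k → 1/ k ! ≈ ι (suc k) * 1/ suc k !
  1/!-suc k = sym (⁻¹-unique (begin
    ι (k !) * (ι (suc k) * 1/ suc k !)  ≈⟨ solve 3 (λ a b c → a :* (b :* c) := b :* a :* c) refl _ _ _ ⟩
    ι (suc k) * ι (k !) * 1/ suc k !    ≈⟨ *-congʳ (natCast-* (suc k) (k !)) ⟨
    ι (suc k !) * 1/ suc k !            ≈⟨ inverseʳ _ (ι≉0 (suc k !) {{suc k ℕ.!≢0}}) ⟩
    1#                                  ∎))

  -- A n k = n! C(2n-k, n) / k!.  The subtraction 2n - k takes place in the field,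
  -- so the recurrences below hold without assuming k ≤ 2n.
  A : ℕ → ℕ → Carrier
  A n k = falling (ι n + ι n - ι k) n * 1/ k !

  -- With y = 2n - k, both sides are `falling y (suc n)` divided by k!: its smallest factor is y - n
  -- = n - k, its largest is y.
  A-rel : ∀ n k → (ι n - ι k) * A n k ≈ ι (suc k) * (ι n + ι n - ι k) * A n (suc k)
  A-rel n k = begin
    (ι n - ι k) * (falling y n * 1/ k !)
      ≈⟨ *-congˡ (*-congˡ (1/!-suc k)) ⟩
    (ι n - ι k) * (falling y n * (ι (suc k) * 1/ suc k !))
      ≈⟨ solve 5 (λ n k f s c → (n :- k) :* (f :* (s :* c)) := (f :* (n :+ n :- k :- n)) :* (s :* c)) refl
           (ι n) (ι k) (falling y n) (ι (suc k)) (1/ suc k !) ⟩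
    falling y (suc n) * (ι (suc k) * 1/ suc k !)
      ≈⟨ *-congʳ (falling-cong (suc n) y≈1+y′) ⟩
    falling (1# + y′) (suc n) * (ι (suc k) * 1/ suc k !)
      ≈⟨ *-congʳ (falling-top y′ n) ⟩
    (1# + y′) * falling y′ n * (ι (suc k) * 1/ suc k !)
      ≈⟨ *-congʳ (*-congʳ y≈1+y′) ⟨
    y * falling y′ n * (ι (suc k) * 1/ suc k !)
      ≈⟨ solve 4 (λ y f s c → y :* f :* (s :* c) := s :* y :* (f :* c)) refl y (falling y′ n) (ι (suc k)) (1/ suc k !) ⟩
    ι (suc k) * y * A n (suc k) ∎
    where
    y  = ι n + ι n - ι k
    y′ = ι n + ι n - ι (suc k)
    y≈1+y′ : y ≈ 1# + y′
    y≈1+y′ = solve 2 (λ n k → n :+ n :- k := :1 :+ (n :+ n :- (:1 :+ k))) refl (ι n) (ι k)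

  -- The shift A_{k-1}; the value 0 at k = 0 stands for 1/(-1)! and kills the lower boundary term of
  -- certificates.
  B : ℕ → ℕ → Carrier
  B n zero    = 0#
  B n (suc k) = A n k

  B-rel : ∀ n k → (1# + ι n - ι k) * B n k ≈ ι k * (1# + ι n + ι n - ι k) * A n k
  B-rel n zero    = solve 2 (λ n a → (:1 :+ n :- :ι 0) :* :ι 0 := :ι 0 :* (:1 :+ n :+ n :- :ι 0) :* a) refl (ι n) (A n 0)
  B-rel n (suc k) = begin
    (1# + ι n - ι (suc k)) * A n k
      ≈⟨ solve 3 (λ n k a → (:1 :+ n :- (:1 :+ k)) :* a := (n :- k) :* a) refl (ι n) (ι k) (A n k) ⟩
    (ι n - ι k) * A n k
      ≈⟨ A-rel n k ⟩
    ι (suc k) * (ι n + ι n - ι k) * A n (suc k)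
      ≈⟨ solve 3 (λ n k a → (:1 :+ k) :* (n :+ n :- k) :* a := (:1 :+ k) :* (:1 :+ n :+ n :- (:1 :+ k)) :* a) refl (ι n) (ι k) (A n (suc k)) ⟩
    ι (suc k) * (1# + ι n + ι n - ι (suc k)) * A n (suc k) ∎

  falling-shift : ∀ y n → (1# + y - ι n) * falling (1# + y) n ≈ (1# + y) * falling y n
  falling-shift y n = trans (*-comm _ _) (falling-top y n)

  -- After splitting off the largest factor 2n + 2 - k, write it as 2(n + 1 - k) + k. The first part
  -- lowers the argument of `falling` by `falling-shift`; the second absorbs k into k!, giving
  -- A_{k-1}.
  A-suc : ∀ n k → A (suc n) k ≈ ι 2 * (1# + ι n + ι n - ι k) * A n k + B n k
  A-suc n zero = begin
    falling (ι (suc n) + ι (suc n) - 0#) (suc n) * w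
      ≈⟨ *-congʳ (falling-cong (suc n) (solve 1 (λ n → :1 :+ n :+ (:1 :+ n) :- :ι 0 := :1 :+ (:1 :+ (n :+ n :- :ι 0))) refl (ι n))) ⟩
    falling (1# + (1# + y)) (suc n) * w
      ≈⟨ *-congʳ (falling-top (1# + y) n) ⟩
    (1# + (1# + y)) * falling (1# + y) n * w
      ≈⟨ solve 3 (λ n f w → (:1 :+ (:1 :+ (n :+ n :- :ι 0))) :* f :* w
                          := :ι 2 :* ((:1 :+ (n :+ n :- :ι 0) :- n) :* f) :* w) refl (ι n) (falling (1# + y) n) w ⟩
    ι 2 * ((1# + y - ι n) * falling (1# + y) n) * w
      ≈⟨ *-congʳ (*-congˡ (falling-shift y n)) ⟩
    ι 2 * ((1# + y) * falling y n) * w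
      ≈⟨ solve 3 (λ n f w → :ι 2 :* ((:1 :+ (n :+ n :- :ι 0)) :* f) :* w
                          := :ι 2 :* (:1 :+ n :+ n :- :ι 0) :* (f :* w) :+ :ι 0) refl (ι n) (falling y n) w ⟩
    ι 2 * (1# + ι n + ι n - 0#) * A n 0 + 0# ∎
    where
    y = ι n + ι n - 0#
    w = 1/ 0 !
  A-suc n (suc k) = begin
    falling (ι (suc n) + ι (suc n) - ι (suc k)) (suc n) * w
      ≈⟨ *-congʳ (falling-cong (suc n) (solve 2 (λ n k → :1 :+ n :+ (:1 :+ n) :- (:1 :+ k) := :1 :+ (:1 :+ (n :+ n :- (:1 :+ k)))) refl (ι n) (ι k))) ⟩
    falling (1# + (1# + y)) (suc n) * w
      ≈⟨ *-congʳ (falling-top (1# + y) n) ⟩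
    (1# + (1# + y)) * falling (1# + y) n * w
      ≈⟨ solve 4 (λ n k f w → let y = n :+ n :- (:1 :+ k) in (:1 :+ (:1 :+ y)) :* f :* w
                          := :ι 2 :* ((:1 :+ y :- n) :* f) :* w :+ f :* ((:1 :+ k) :* w)) refl (ι n) (ι k) (falling (1# + y) n) w ⟩
    ι 2 * ((1# + y - ι n) * falling (1# + y) n) * w + falling (1# + y) n * (ι (suc k) * w)
      ≈⟨ +-cong (*-congʳ (*-congˡ (falling-shift y n))) (*-cong (falling-cong n 1+y≈) (sym (1/!-suc k))) ⟩
    ι 2 * ((1# + y) * falling y n) * w + A n k
      ≈⟨ solve 5 (λ n k f w a → :ι 2 :* ((:1 :+ (n :+ n :- (:1 :+ k))) :* f) :* w :+ a
                          := :ι 2 :* (:1 :+ n :+ n :- (:1 :+ k)) :* (f :* w) :+ a) refl (ι n) (ι k) (falling y n) w (A n k) ⟩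
    ι 2 * (1# + ι n + ι n - ι (suc k)) * A n (suc k) + A n k ∎
    where
    y = ι n + ι n - ι (suc k)
    w = 1/ suc k !
    1+y≈ : 1# + y ≈ ι n + ι n - ι k
    1+y≈ = solve 2 (λ n k → :1 :+ (n :+ n :- (:1 :+ k)) := n :+ n :- k) refl (ι n) (ι k)

  -- Both are 1. This serves the top summand k = n + 1 of the sums for n + 1, which lies outside the
  -- telescoping range.
  A-diagonal : ∀ n → A (suc n) (suc n) ≈ A n n
  A-diagonal n = begin
    falling (ι (suc n) + ι (suc n) - ι (suc n)) (suc n) * 1/ suc n !
      ≈⟨ *-congʳ (falling-cong (suc n) (solve 1 (λ n → :1 :+ n :+ (:1 :+ n) :- (:1 :+ n) := :1 :+ (n :+ n :- n)) refl (ι n))) ⟩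
    falling (1# + (ι n + ι n - ι n)) (suc n) * 1/ suc n !
      ≈⟨ *-congʳ (falling-top _ n) ⟩
    (1# + (ι n + ι n - ι n)) * falling (ι n + ι n - ι n) n * 1/ suc n !
      ≈⟨ solve 3 (λ n f c → (:1 :+ (n :+ n :- n)) :* f :* c := f :* ((:1 :+ n) :* c)) refl (ι n) _ _ ⟩
    falling (ι n + ι n - ι n) n * (ι (suc n) * 1/ suc n !)
      ≈⟨ *-congˡ (1/!-suc n) ⟨
    A n n ∎

-- Summation by parts for the moments of A_k.

module Telescoping {c ℓ} (F : Char0Field c ℓ) (x : Char0Field.Carrier F) (n : ℕ) where
  open Char0Field F
  open FieldOps F
  open FieldLemmas F
  open Coefficients F
  open IntegerCoefficientSolver commutativeRing
  open import Relation.Binary.Reasoning.Setoid setoid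

  private
    N = ι n

  -- The passage from n to n + 1 multiplies P by (x + 2n + 2 + y)(x + 2n + 3 - y) = C - u + y,
  -- whence the recurrences for E and O.
  C : Carrier
  C = (x + (N + N + ι 2)) * (x + (N + N + ι 3))

  -- `step` is u Q_k = (x+k+1)² Q_k - Q_{k+1}, divided by (x+1)_{k+1} and read at one power of u.
  -- Abstract q and t serve both coefficients: (`r`, 0) for that of 1 and, up to a common sign,
  -- (`h`, -`z`) for that of u.
  module _ (q t : ℕ → Carrier)
           (step : ∀ k → k ℕ.≤ n → t k ≈ (x + ι (suc k)) * q k - q (suc k)) where

    M₀ = Σ₀ n (λ k → A n k * q k)
    M₁ = Σ₀ n (λ k → ι k * A n k * q k)
    M₂ = Σ₀ n (λ k → ι k * ι k * A n k * q k)

    -- The normalised form of E' = (C - u) E + u O: -u E contributes -A_k (x+k+1) t_k and u O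
    -- contributes -A_k t_k.
    M₀-suc : (x + N + ι 2) * Σ₀ (suc n) (λ k → A (suc n) k * q k)
           ≈ C * M₀ - Σ₀ n (λ k → A n k * ((x + ι k + ι 2) * t k))
    M₀-suc = begin
      (x + N + ι 2) * Σ₀ (suc n) (λ k → A (suc n) k * q k)
        ≈⟨ Σ₀-* (suc n) _ _ ⟨
      Σ₀ (suc n) f
        ≈⟨ Σ₀-suc n f ⟩
      Σ₀ n f + (x + N + ι 2) * (A (suc n) (suc n) * q (suc n))
        ≈⟨ +-congˡ (*-congˡ (*-congʳ (A-diagonal n))) ⟩
      Σ₀ n f + (x + N + ι 2) * (A n n * q (suc n))
        ≈⟨ +-congˡ (solve 4 (λ x n a q → (x :+ n :+ :ι 2) :* (a :* q) := a :* (x :+ (:1 :+ (:1 :+ n))) :* q) refl x N _ _) ⟩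
      Σ₀ n f + G (suc n)
        ≈⟨ Σ₀-telescope n f g G (trans (*-congʳ (zeroˡ _)) (zeroˡ _)) term ⟩
      Σ₀ n g
        ≈⟨ Σ₀-+ n _ _ ⟩
      Σ₀ n (λ k → C * (A n k * q k)) + Σ₀ n (λ k → - 1# * (A n k * ((x + ι k + ι 2) * t k)))
        ≈⟨ +-cong (Σ₀-* n _ _) (Σ₀-* n _ _) ⟩
      C * M₀ + - 1# * Σ₀ n (λ k → A n k * ((x + ι k + ι 2) * t k))
        ≈⟨ solve 2 (λ a b → a :+ :- :1 :* b := a :- b) refl _ _ ⟩
      C * M₀ - Σ₀ n (λ k → A n k * ((x + ι k + ι 2) * t k)) ∎
      where
      f = λ k → (x + N + ι 2) * (A (suc n) k * q k)
      g = λ k → C * (A n k * q k) + - 1# * (A n k * ((x + ι k + ι 2) * t k))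
      -- `G (suc k)` is the q_{k+1} part that arises when `step` replaces t. At k = n it is the top
      -- summand of the left side.
      G = λ k → B n k * (x + ι (suc k)) * q k
      term : ∀ k → k ℕ.≤ n → f k + G (suc k) ≈ g k + G k
      term k k≤n =
        modulo (*-congˡ {A n k * (x + ι k + ι 2)} (step k k≤n))
        (modulo (*-congˡ {(x + N + ι 2) * q k} (A-suc n k))
        (modulo (*-congˡ {q k} (B-rel n k))
        (solve 9 (λ x n k a a′ b q q′ t →
           let C = (x :+ (n :+ n :+ :ι 2)) :* (x :+ (n :+ n :+ :ι 3))
               s = x :+ k :+ :ι 2 in
           (x :+ n :+ :ι 2) :* (a′ :* q) :+ a :* (x :+ (:1 :+ (:1 :+ k))) :* q′
             :+ a :* s :* ((x :+ (:1 :+ k)) :* q :- q′)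
             :+ (x :+ n :+ :ι 2) :* q :* (:ι 2 :* (:1 :+ n :+ n :- k) :* a :+ b)
             :+ q :* (k :* (:1 :+ n :+ n :- k) :* a)
           := C :* (a :* q) :+ :- :1 :* (a :* (s :* t)) :+ b :* (x :+ (:1 :+ k)) :* q
             :+ a :* s :* t
             :+ (x :+ n :+ :ι 2) :* q :* a′
             :+ q :* ((:1 :+ n :- k) :* b))
           refl x N (ι k) (A n k) (A (suc n) k) (B n k) (q k) (q (suc k)) (t k))))

    private
      -- Makes both certificates below vanish at k = n + 1. The factor 1 + 2n - k is kept because
      -- `A n (suc n)` alone is 1 when n = 0.
      k[1+2n-k]A≈0 : (1# + N) * (1# + N + N - (1# + N)) * A n (suc n) ≈ 0#
      k[1+2n-k]A≈0 = begin
        (1# + N) * (1# + N + N - (1# + N)) * A n (suc n)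
          ≈⟨ solve 2 (λ n a → (:1 :+ n) :* (:1 :+ n :+ n :- (:1 :+ n)) :* a := (:1 :+ n) :* (n :+ n :- n) :* a) refl N _ ⟩
        (1# + N) * (N + N - N) * A n (suc n)
          ≈⟨ A-rel n n ⟨
        (N - N) * A n n
          ≈⟨ solve 2 (λ n a → (n :- n) :* a := :ι 0) refl N (A n n) ⟩
        0# ∎

    -- For the certificate k (1 + 2n - k) A_k q_k, `A-rel` and `step` rewrite the shifted term as (n
    -- - k) A_k ((x+k+1) q_k - t_k). In the difference the k² terms cancel, leaving only moments of
    -- order 0 and 1.
    M₁-M₀ : (x + N + ι 2) * M₁ ≈ N * (x + 1#) * M₀ + Σ₀ n (λ k → (ι k - N) * A n k * t k)
    M₁-M₀ = begin
      (x + N + ι 2) * M₁        ≈⟨ Σ₀-* n _ _ ⟨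
      Σ₀ n f                    ≈⟨ +-identityʳ _ ⟨
      Σ₀ n f + 0#               ≈⟨ +-congˡ (trans (*-congʳ k[1+2n-k]A≈0) (zeroˡ _)) ⟨
      Σ₀ n f + G (suc n)        ≈⟨ Σ₀-telescope n f g G (solve 3 (λ n a q → :ι 0 :* (:1 :+ n :+ n :- :ι 0) :* a :* q := :ι 0) refl N (A n 0) (q 0)) term ⟩
      Σ₀ n g                    ≈⟨ Σ₀-+ n _ _ ⟩
      Σ₀ n (λ k → N * (x + 1#) * (A n k * q k)) + Σ₀ n (λ k → (ι k - N) * A n k * t k)
                                ≈⟨ +-congʳ (Σ₀-* n _ _) ⟩
      N * (x + 1#) * M₀ + Σ₀ n (λ k → (ι k - N) * A n k * t k) ∎
      where
      f = λ k → (x + N + ι 2) * (ι k * A n k * q k)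
      g = λ k → N * (x + 1#) * (A n k * q k) + (ι k - N) * A n k * t k
      G = λ k → ι k * (1# + N + N - ι k) * A n k * q k
      term : ∀ k → k ℕ.≤ n → f k + G (suc k) ≈ g k + G k
      term k k≤n =
        modulo (*-congˡ {(N - ι k) * A n k} (step k k≤n))
        (modulo (*-congˡ {q (suc k)} (sym (A-rel n k)))
        (solve 8 (λ x n k a a₁ q q₁ t →
           (x :+ n :+ :ι 2) :* (k :* a :* q) :+ (:1 :+ k) :* (:1 :+ n :+ n :- (:1 :+ k)) :* a₁ :* q₁
             :+ (n :- k) :* a :* ((x :+ (:1 :+ k)) :* q :- q₁)
             :+ q₁ :* ((n :- k) :* a)
           := n :* (x :+ :1) :* (a :* q) :+ (k :- n) :* a :* t :+ k :* (:1 :+ n :+ n :- k) :* a :* q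
             :+ (n :- k) :* a :* t
             :+ q₁ :* ((:1 :+ k) :* (n :+ n :- k) :* a₁))
           refl x N (ι k) (A n k) (A n (suc k)) (q k) (q (suc k)) (t k)))

    -- The certificate of `M₁-M₀` with an extra factor x + k: now the k³ terms cancel and k² is left
    -- with the coefficient -(n + x + 3).
    M₂-M₁-M₀ : (N + x + ι 3) * M₂
             ≈ Σ₀ n (λ k → (ι k - N) * A n k * ((x + ι (suc k)) * t k))
               + (ι 2 * N - x * x - ι 3 * x - 1#) * M₁
               + N * (x + 1#) * (x + 1#) * M₀
    M₂-M₁-M₀ = begin
      (N + x + ι 3) * M₂        ≈⟨ Σ₀-* n _ _ ⟨
      Σ₀ n f                    ≈⟨ +-identityʳ _ ⟨
      Σ₀ n f + 0#               ≈⟨ +-congˡ (trans (*-congʳ (trans (*-congˡ k[1+2n-k]A≈0) (zeroʳ _))) (zeroˡ _)) ⟨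
      Σ₀ n f + G (suc n)        ≈⟨ Σ₀-telescope n f g G (solve 4 (λ x n a q → (x :+ :ι 0) :* (:ι 0 :* (:1 :+ n :+ n :- :ι 0) :* a) :* q := :ι 0) refl x N (A n 0) (q 0)) term ⟩
      Σ₀ n g                    ≈⟨ trans (Σ₀-+ n _ _) (+-congʳ (Σ₀-+ n _ _)) ⟩
      Σ₀ n (λ k → (ι k - N) * A n k * ((x + ι (suc k)) * t k))
        + Σ₀ n (λ k → (ι 2 * N - x * x - ι 3 * x - 1#) * (ι k * A n k * q k))
        + Σ₀ n (λ k → N * (x + 1#) * (x + 1#) * (A n k * q k))
                                ≈⟨ +-cong (+-congˡ (Σ₀-* n _ _)) (Σ₀-* n _ _) ⟩
      _ ∎
      where
      f = λ k → (N + x + ι 3) * (ι k * ι k * A n k * q k)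
      g = λ k → (ι k - N) * A n k * ((x + ι (suc k)) * t k)
              + (ι 2 * N - x * x - ι 3 * x - 1#) * (ι k * A n k * q k)
              + N * (x + 1#) * (x + 1#) * (A n k * q k)
      G = λ k → (x + ι k) * (ι k * (1# + N + N - ι k) * A n k) * q k
      term : ∀ k → k ℕ.≤ n → f k + G (suc k) ≈ g k + G k
      term k k≤n =
        modulo (*-congˡ {(N - ι k) * A n k * (x + ι (suc k))} (step k k≤n))
        (modulo (*-congˡ {(x + ι (suc k)) * q (suc k)} (sym (A-rel n k)))
        (solve 8 (λ x n k a a₁ q q₁ t → let s = x :+ (:1 :+ k) in
           (n :+ x :+ :ι 3) :* (k :* k :* a :* q) :+ s :* ((:1 :+ k) :* (:1 :+ n :+ n :- (:1 :+ k)) :* a₁) :* q₁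
             :+ (n :- k) :* a :* s :* (s :* q :- q₁)
             :+ s :* q₁ :* ((n :- k) :* a)
           := (k :- n) :* a :* (s :* t) :+ (:ι 2 :* n :- x :* x :- :ι 3 :* x :- :1) :* (k :* a :* q)
             :+ n :* (x :+ :1) :* (x :+ :1) :* (a :* q)
             :+ (x :+ k) :* (k :* (:1 :+ n :+ n :- k) :* a) :* q
             :+ (n :- k) :* a :* s :* t
             :+ s :* q₁ :* ((:1 :+ k) :* (n :+ n :- k) :* a₁))
           refl x N (ι k) (A n k) (A n (suc k)) (q k) (q (suc k)) (t k)))

-- The coefficients of 1 and u, and the harmonic sums they produce.

module ClosedForms {c ℓ} (F : Char0Field c ℓ) (x : Char0Field.Carrier F) where
  open Char0Field F
  open FieldOps F
  open FieldLemmas F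
  open Coefficients F
  open IntegerCoefficientSolver commutativeRing
  open import Relation.Binary.Reasoning.Setoid setoid

  Nonvanishing : ℕ → Set ℓ
  Nonvanishing m = ∀ k → 1 ℕ.≤ k → k ℕ.≤ m → ¬ (x + ι k ≈ 0#)

  g : ℕ → Carrier
  g k = (x + ι k) ⁻¹

  -- The rising factorial (x+1)_k, constant coefficient of Q_k / (x+1)_k.
  r : ℕ → Carrier
  r zero    = 1#
  r (suc k) = (x + ι (suc k)) * r k

  -- The constant coefficient of Q_k / (x+1)_{k+1}.
  z : ℕ → Carrier
  z k = r k * g (suc k)

  -- Minus the coefficient of u in Q_k / (x+1)_k.
  h : ℕ → Carrier
  h k = r k * Hˡ 2 k x

  [x+k]g≈1 : ∀ {m} → Nonvanishing m → ∀ k → suc k ℕ.≤ m → (x + ι (suc k)) * g (suc k) ≈ 1#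
  [x+k]g≈1 nz k k<m = inverseʳ _ (nz (suc k) (ℕ.s≤s ℕ.z≤n) k<m)

  [x+k]z≈r : ∀ {m} → Nonvanishing m → ∀ k → suc k ℕ.≤ m → (x + ι (suc k)) * z k ≈ r k
  [x+k]z≈r nz k k<m = begin
    (x + ι (suc k)) * (r k * g (suc k))  ≈⟨ solve 3 (λ s r g → s :* (r :* g) := r :* (s :* g)) refl _ _ _ ⟩
    r k * ((x + ι (suc k)) * g (suc k))  ≈⟨ *-congˡ ([x+k]g≈1 nz k k<m) ⟩
    r k * 1#                             ≈⟨ *-identityʳ _ ⟩
    r k                                  ∎

  H²-suc : ∀ {m} → Nonvanishing m → ∀ k → suc k ℕ.≤ m →
           Hˡ 2 (suc k) x ≈ Hˡ 2 k x + g (suc k) * g (suc k)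
  H²-suc nz k k<m = +-congˡ (1/pow2 _ (nz (suc k) (ℕ.s≤s ℕ.z≤n) k<m))

  -- u Q_k has no constant term, hence t = 0.
  r-step : ∀ k → 0# ≈ (x + ι (suc k)) * r k - r (suc k)
  r-step k = sym (-‿inverseʳ _)

  -- The coefficient of u in u Q_k is the constant one of Q_k; the minus sign comes from that of
  -- `h`.
  h-step : ∀ {m} → Nonvanishing m → ∀ k → suc k ℕ.≤ m →
           - z k ≈ (x + ι (suc k)) * h k - h (suc k)
  h-step nz k k<m =
    modulo (*-congˡ {r (suc k)} (H²-suc nz k k<m))
    (modulo (*-congˡ {r k * g (suc k)} ([x+k]g≈1 nz k k<m))
    (solve 5 (λ s r g H H′ →
       :- (r :* g) :+ s :* r :* (H :+ g :* g) :+ r :* g :* :1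
       := s :* (r :* H) :- s :* r :* H′ :+ s :* r :* H′ :+ r :* g :* (s :* g))
       refl (x + ι (suc k)) (r k) (g (suc k)) (Hˡ 2 k x) (Hˡ 2 (suc k) x)))

  -- Let ε_j = (-1)^j / (x+j) for 1 ≤ j ≤ 2n+1. Then `D n` is 2 Σ ε_j, the summands of its two parts
  -- being 2/(x+2k) and 2/(x+2k-1), and `H² n` is Σ ε_j².
  W V U D H² : ℕ → Carrier
  W n = Σ₀ n (λ k → A n k * r k)
  V n = Σ₀ n (λ k → A n k * z k)
  U n = Σ₀ n (λ k → A n k * h k)
  D n = H n (x / ι 2) - H (suc n) ((x - 1#) / ι 2)
  H² n = Hˡ 2 (suc (n ℕ.+ n)) x

  C : ℕ → Carrier
  C n = Telescoping.C F x n

  1+n≤1+2n : ∀ n → suc n ℕ.≤ suc (n ℕ.+ n)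
  1+n≤1+2n n = ℕ.s≤s (ℕ.m≤m+n n n)

  1+k≤1+2n : ∀ {k n} → k ℕ.≤ n → suc k ℕ.≤ suc (n ℕ.+ n)
  1+k≤1+2n {n = n} k≤n = ℕ.≤-trans (ℕ.s≤s k≤n) (1+n≤1+2n n)

  Σ₀-zero : ∀ n f → (∀ k → k ℕ.≤ n → f k ≈ 0#) → Σ₀ n f ≈ 0#
  Σ₀-zero n f f≈0 = begin
    Σ₀ n f                 ≈⟨ Σ₀-cong n (λ k k≤n → trans (f≈0 k k≤n) (sym (zeroˡ 0#))) ⟩
    Σ₀ n (λ _ → 0# * 0#)   ≈⟨ Σ₀-* n 0# (λ _ → 0#) ⟩
    0# * Σ₀ n (λ _ → 0#)   ≈⟨ zeroˡ _ ⟩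
    0#                     ∎

  -- Recurrences in n for W, U and V.

  W-suc : ∀ n → (x + ι n + ι 2) * W (suc n) ≈ C n * W n
  W-suc n = begin
    (x + ι n + ι 2) * W (suc n)
      ≈⟨ Telescoping.M₀-suc F x n r (λ _ → 0#) (λ k _ → r-step k) ⟩
    C n * W n - Σ₀ n (λ k → A n k * ((x + ι k + ι 2) * 0#))
      ≈⟨ +-congˡ (-‿cong (Σ₀-zero n _ (λ k _ → trans (*-congˡ (zeroʳ _)) (zeroʳ _)))) ⟩
    C n * W n - 0#
      ≈⟨ solve 1 (λ a → a :- :ι 0 := a) refl _ ⟩
    C n * W n ∎

  -- In `M₀-suc` with t = -z, the splitting x+k+2 = (x+k+1) + 1 turns the correction into W + V.
  U-suc : ∀ n → Nonvanishing (suc (n ℕ.+ n)) → (x + ι n + ι 2) * U (suc n) ≈ C n * U n + (W n + V n)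
  U-suc n nz = begin
    (x + ι n + ι 2) * U (suc n)
      ≈⟨ Telescoping.M₀-suc F x n h (λ k → - z k) (λ k k≤n → h-step nz k (1+k≤1+2n k≤n)) ⟩
    C n * U n - Σ₀ n (λ k → A n k * ((x + ι k + ι 2) * - z k))
      ≈⟨ +-congˡ (-‿cong sum) ⟩
    C n * U n - - 1# * (W n + V n)
      ≈⟨ solve 2 (λ a b → a :- :- :1 :* b := a :+ b) refl _ _ ⟩
    C n * U n + (W n + V n) ∎
    where
    term : ∀ k → k ℕ.≤ n → A n k * ((x + ι k + ι 2) * - z k) ≈ - 1# * (A n k * r k + A n k * z k)
    term k k≤n =
      modulo (*-congˡ { - A n k} ([x+k]z≈r nz k (1+k≤1+2n k≤n)))
      (solve 5 (λ x k a r z →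
         a :* ((x :+ k :+ :ι 2) :* :- z) :+ :- a :* r
         := :- :1 :* (a :* r :+ a :* z) :+ :- a :* ((x :+ (:1 :+ k)) :* z))
         refl x (ι k) (A n k) (r k) (z k))
    sum : Σ₀ n (λ k → A n k * ((x + ι k + ι 2) * - z k)) ≈ - 1# * (W n + V n)
    sum = trans (Σ₀-cong n term) (trans (Σ₀-* n _ _) (*-congˡ (Σ₀-+ n _ _)))

  -- The constant coefficient of O' = (C - u) O + E, where O becomes -V. The value of the
  -- certificate at n + 1 is the top summand, because (x+n+2) z_{n+1} = r_{n+1}.
  V-suc : ∀ n → Nonvanishing (suc (suc n ℕ.+ suc n)) → (x + ι n + ι 2) * V (suc n) ≈ C n * V n - W n
  V-suc n nz = begin
    (x + N + ι 2) * V (suc n)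
      ≈⟨ Σ₀-* (suc n) _ _ ⟨
    Σ₀ (suc n) f
      ≈⟨ Σ₀-suc n f ⟩
    Σ₀ n f + (x + N + ι 2) * (A (suc n) (suc n) * z (suc n))
      ≈⟨ +-congˡ (*-congˡ (*-congʳ (A-diagonal n))) ⟩
    Σ₀ n f + (x + N + ι 2) * (A n n * z (suc n))
      ≈⟨ +-congˡ (solve 4 (λ x n a z → (x :+ n :+ :ι 2) :* (a :* z) := a :* ((x :+ (:1 :+ (:1 :+ n))) :* z)) refl x N _ _) ⟩
    Σ₀ n f + A n n * ((x + ι (suc (suc n))) * z (suc n))
      ≈⟨ +-congˡ (*-congˡ ([x+k]z≈r nz (suc n) (1+n≤1+2n (suc n)))) ⟩
    Σ₀ n f + A n n * r (suc n)
      ≈⟨ Σ₀-telescope n f s G (zeroˡ _) term ⟩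
    Σ₀ n s
      ≈⟨ Σ₀-+ n _ _ ⟩
    Σ₀ n (λ k → C n * (A n k * z k)) + Σ₀ n (λ k → - 1# * (A n k * r k))
      ≈⟨ +-cong (Σ₀-* n _ _) (Σ₀-* n _ _) ⟩
    C n * V n + - 1# * W n
      ≈⟨ solve 2 (λ a b → a :+ :- :1 :* b := a :- b) refl _ _ ⟩
    C n * V n - W n ∎
    where
    N = ι n
    f = λ k → (x + N + ι 2) * (A (suc n) k * z k)
    s = λ k → C n * (A n k * z k) + - 1# * (A n k * r k)
    G = λ k → B n k * r k
    term : ∀ k → k ℕ.≤ n → f k + G (suc k) ≈ s k + G k
    term k k≤n =
      modulo (*-congˡ {A n k * (x + ι (suc k)) + A n k - B n k} (sym ([x+k]z≈r nz k (1+k≤1+2n (ℕ.m≤n⇒m≤1+n k≤n)))))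
      (modulo (*-congˡ {(x + N + ι 2) * z k} (A-suc n k))
      (modulo (*-congˡ {z k} (B-rel n k))
      (solve 8 (λ x n k a a′ b r z →
         let s = x :+ (:1 :+ k) ; e = a :* s :+ a :- b in
         (x :+ n :+ :ι 2) :* (a′ :* z) :+ a :* (s :* r)
           :+ e :* (s :* z)
           :+ (x :+ n :+ :ι 2) :* z :* (:ι 2 :* (:1 :+ n :+ n :- k) :* a :+ b)
           :+ z :* (k :* (:1 :+ n :+ n :- k) :* a)
         := (x :+ (n :+ n :+ :ι 2)) :* (x :+ (n :+ n :+ :ι 3)) :* (a :* z) :+ :- :1 :* (a :* r) :+ b :* r
           :+ e :* r
           :+ (x :+ n :+ :ι 2) :* z :* a′
           :+ z :* ((:1 :+ n :- k) :* b))
         refl x N (ι k) (A n k) (A (suc n) k) (B n k) (r k) (z k))))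

  -- Closed forms of W, V and U by induction on n.

  A00≈1 : A 0 0 ≈ 1#
  A00≈1 = trans (*-identityˡ _) (sym (⁻¹-unique (solve 0 (:ι 1 :* :1 := :1) refl)))

  ι-double : ∀ n → ι (n ℕ.+ n) ≈ ι n + ι n
  ι-double n = ι-+ n n

  x+2+n≉0 : ∀ n → Nonvanishing (suc (suc n ℕ.+ suc n)) → ¬ (x + ι n + ι 2 ≈ 0#)
  x+2+n≉0 n nz eq = nz (suc (suc n)) (ℕ.s≤s ℕ.z≤n) (1+n≤1+2n (suc n))
    (trans (solve 2 (λ x n → x :+ (:1 :+ (:1 :+ n)) := x :+ n :+ :ι 2) refl x (ι n)) eq)

  weaken : ∀ n → Nonvanishing (suc (suc n ℕ.+ suc n)) → Nonvanishing (suc (n ℕ.+ n))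
  weaken n nz k 1≤k k≤ = nz k 1≤k (ℕ.≤-trans k≤ (ℕ.s≤s (ℕ.+-mono-≤ (ℕ.n≤1+n n) (ℕ.n≤1+n n))))

  -- The value is P(0) / (x+1)_{n+1} = (x+n+2)⋯(x+2n+1). In the induction, C supplies the two new
  -- top factors and the cancelled x+n+2 is the bottom factor that drops out.
  W-closed : ∀ n → Nonvanishing (suc (n ℕ.+ n)) → W n ≈ falling (x + (1# + (ι n + ι n))) n
  W-closed zero    nz = trans (+-identityʳ _) (trans (*-identityʳ _) A00≈1)
  W-closed (suc n) nz = *-cancelˡ-≉0 (x+2+n≉0 n nz) (begin
    (x + N + ι 2) * W (suc n)
      ≈⟨ W-suc n ⟩
    C n * W n
      ≈⟨ *-congˡ (W-closed n (weaken n nz)) ⟩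
    C n * falling y n
      ≈⟨ solve 3 (λ x n f → let y = x :+ (:1 :+ (n :+ n)) in
           (x :+ (n :+ n :+ :ι 2)) :* (x :+ (n :+ n :+ :ι 3)) :* f
           := (:1 :+ (:1 :+ y)) :* ((:1 :+ y) :* f)) refl x N _ ⟩
    (1# + (1# + y)) * ((1# + y) * falling y n)
      ≈⟨ *-congˡ (falling-top y n) ⟨
    (1# + (1# + y)) * falling (1# + y) (suc n)
      ≈⟨ falling-top (1# + y) (suc n) ⟨
    falling (1# + (1# + y)) (suc n) * (1# + (1# + y) - ι (suc n))
      ≈⟨ solve 3 (λ x n f → let y = x :+ (:1 :+ (n :+ n)) in
           f :* (:1 :+ (:1 :+ y) :- (:1 :+ n)) := (x :+ n :+ :ι 2) :* f) refl x N _ ⟩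
    (x + N + ι 2) * falling (1# + (1# + y)) (suc n)
      ≈⟨ *-congˡ (falling-cong (suc n) (solve 2 (λ x n → :1 :+ (:1 :+ (x :+ (:1 :+ (n :+ n)))) := x :+ (:1 :+ (:1 :+ n :+ (:1 :+ n)))) refl x N)) ⟩
    (x + N + ι 2) * falling (x + (1# + (ι (suc n) + ι (suc n)))) (suc n) ∎)
    where
    N = ι n
    y = x + (1# + (N + N))

  -- Turns the summands of the harmonic numbers at x/2 and (x-1)/2 into 2/(x+j).
  1/[y/2+m] : ∀ {y a} m → ¬ (a ≈ 0#) → y + (ι m + ι m) ≈ a → 1# / pow (y / ι 2 + ι m) 1 ≈ ι 2 * a ⁻¹
  1/[y/2+m] {y} {a} m a≉0 eq = trans (1/pow1 _) (sym (⁻¹-unique (begin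
    (y * i + ι m) * (ι 2 * a ⁻¹)            ≈⟨ solve 4 (λ y i m b → (y :* i :+ m) :* (:ι 2 :* b) := (y :* (:ι 2 :* i) :+ (m :+ m)) :* b) refl _ _ _ _ ⟩
    (y * (ι 2 * i) + (ι m + ι m)) * a ⁻¹    ≈⟨ *-congʳ (+-congʳ (trans (*-congˡ (inverseʳ (ι 2) (char0 1))) (*-identityʳ y))) ⟩
    (y + (ι m + ι m)) * a ⁻¹                ≈⟨ *-congʳ eq ⟩
    a * a ⁻¹                                ≈⟨ inverseʳ a a≉0 ⟩
    1#                                      ∎)))
    where i = ι 2 ⁻¹

  2+2n : ℕ → ℕ
  2+2n n = suc (suc (n ℕ.+ n))

  1+2[1+n] : ∀ n → suc (suc n ℕ.+ suc n) ≡ suc (2+2n n)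
  1+2[1+n] n = ≡.cong (λ k → suc (suc k)) (ℕ.+-suc n n)

  module _ (n : ℕ) (nz : Nonvanishing (suc (suc n ℕ.+ suc n))) where
    private
      nz′ : Nonvanishing (suc (2+2n n))
      nz′ = ≡.subst Nonvanishing (1+2[1+n] n) nz

      a≈ : x + ι (2+2n n) ≈ x + (ι n + ι n + ι 2)
      a≈ = trans (+-congˡ (+-congˡ (+-congˡ (ι-double n)))) (solve 2 (λ x m → x :+ (:1 :+ (:1 :+ m)) := x :+ (m :+ :ι 2)) refl x _)

      b≈ : x + ι (suc (2+2n n)) ≈ x + (ι n + ι n + ι 3)
      b≈ = trans (+-congˡ (+-congˡ (+-congˡ (+-congˡ (ι-double n))))) (solve 2 (λ x m → x :+ (:1 :+ (:1 :+ (:1 :+ m))) := x :+ (m :+ :ι 3)) refl x _)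

    [x+2+2n]g≈1 : (x + (ι n + ι n + ι 2)) * g (2+2n n) ≈ 1#
    [x+2+2n]g≈1 = trans (*-congʳ (sym a≈)) ([x+k]g≈1 nz′ _ (ℕ.n≤1+n _))

    [x+3+2n]g≈1 : (x + (ι n + ι n + ι 3)) * g (suc (2+2n n)) ≈ 1#
    [x+3+2n]g≈1 = trans (*-congʳ (sym b≈)) ([x+k]g≈1 nz′ _ ℕ.≤-refl)

    H²-suc-suc : H² (suc n) ≈ H² n + g (2+2n n) * g (2+2n n) + g (suc (2+2n n)) * g (suc (2+2n n))
    H²-suc-suc = begin
      H² (suc n)                    ≡⟨ ≡.cong (λ k → Hˡ 2 k x) (1+2[1+n] n) ⟩
      Hˡ 2 (suc (2+2n n)) x         ≈⟨ H²-suc nz′ _ ℕ.≤-refl ⟩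
      Hˡ 2 (2+2n n) x + _           ≈⟨ +-congʳ (H²-suc nz′ _ (ℕ.n≤1+n _)) ⟩
      _ ∎

    -- The even index j = 2n+2 enters through the harmonic number at x/2, the odd one j = 2n+3
    -- through that at (x-1)/2.
    D-suc : D (suc n) ≈ D n + ι 2 * g (2+2n n) - ι 2 * g (suc (2+2n n))
    D-suc = begin
      H n (x / ι 2) + p - (H (suc n) ((x - 1#) / ι 2) + q)
        ≈⟨ solve 4 (λ a p b q → a :+ p :- (b :+ q) := a :- b :+ p :- q) refl _ p _ q ⟩
      D n + p - q
        ≈⟨ +-cong (+-congˡ p≈) (-‿cong q≈) ⟩
      D n + ι 2 * g (2+2n n) - ι 2 * g (suc (2+2n n)) ∎
      where
      p = 1# / pow (x / ι 2 + ι (suc n)) 1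
      q = 1# / pow ((x - 1#) / ι 2 + ι (suc (suc n))) 1
      p≈ : p ≈ ι 2 * g (2+2n n)
      p≈ = 1/[y/2+m] (suc n) (nz′ _ (ℕ.s≤s ℕ.z≤n) (ℕ.n≤1+n _))
        (trans (solve 2 (λ x n → x :+ (:1 :+ n :+ (:1 :+ n)) := x :+ (n :+ n :+ :ι 2)) refl x (ι n)) (sym a≈))
      q≈ : q ≈ ι 2 * g (suc (2+2n n))
      q≈ = 1/[y/2+m] (suc (suc n)) (nz′ _ (ℕ.s≤s ℕ.z≤n) ℕ.≤-refl)
        (trans (solve 2 (λ x n → x :- :1 :+ (:1 :+ (:1 :+ n) :+ (:1 :+ (:1 :+ n))) := x :+ (n :+ n :+ :ι 3)) refl x (ι n)) (sym b≈))

  private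
    D0 : Nonvanishing 1 → D 0 ≈ - (ι 2 * g 1)
    D0 nz = begin
      0# - (0# + q)      ≈⟨ solve 1 (λ q → :ι 0 :- (:ι 0 :+ q) := :- q) refl q ⟩
      - q                ≈⟨ -‿cong (1/[y/2+m] 1 (nz 1 ℕ.≤-refl ℕ.≤-refl) (solve 1 (λ x → x :- :1 :+ (:ι 1 :+ :ι 1) := x :+ :ι 1) refl x)) ⟩
      - (ι 2 * g 1)      ∎
      where q = 1# / pow ((x - 1#) / ι 2 + ι 1) 1

  -- The coefficient of y in P(y)/P(0) = ∏ (1 + ε_j y) is Σ ε_j = D/2, and V carries the opposite
  -- sign.
  V-closed : ∀ n → Nonvanishing (suc (n ℕ.+ n)) → ι 2 * V n ≈ - (W n * D n)
  V-closed zero nz = begin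
    ι 2 * (A 0 0 * (1# * g 1) + 0#)
      ≈⟨ solve 2 (λ a g → :ι 2 :* (a :* (:1 :* g) :+ :ι 0) := :- ((a :* :1 :+ :ι 0) :* :- (:ι 2 :* g))) refl (A 0 0) (g 1) ⟩
    - (W 0 * - (ι 2 * g 1))
      ≈⟨ -‿cong (*-congˡ (D0 nz)) ⟨
    - (W 0 * D 0) ∎
  V-closed (suc n) nz = *-cancelˡ-≉0 (x+2+n≉0 n nz)
    (modulo (*-congˡ {ι 2} (V-suc n nz))
    (modulo (*-congˡ {C n} (V-closed n (weaken n nz)))
    (modulo (*-congˡ {D (suc n)} (W-suc n))
    (modulo (*-congˡ {C n * W n} (D-suc n nz))
    -- With α and β inverse to a = x+2n+2 and b = x+2n+3, C (2α - 2β) = 2b - 2a = 2, which accounts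
    -- for the term -W of `V-suc`.
    (modulo (*-congˡ {ι 2 * (x + (N + N + ι 3)) * W n} ([x+2+2n]g≈1 n nz))
    (modulo (*-congˡ { - (ι 2 * (x + (N + N + ι 2)) * W n)} ([x+3+2n]g≈1 n nz))
    (solve 10 (λ x n v v′ w w′ d d′ α β →
       let s = x :+ n :+ :ι 2 ; a = x :+ (n :+ n :+ :ι 2) ; b = x :+ (n :+ n :+ :ι 3) ; c = a :* b in
       s :* (:ι 2 :* v′) :+ :ι 2 :* (c :* v :- w) :+ c :* :- (w :* d) :+ d′ :* (c :* w)
         :+ c :* w :* (d :+ :ι 2 :* α :- :ι 2 :* β) :+ :ι 2 :* b :* w :* :1 :+ :- (:ι 2 :* a :* w) :* :1
       := s :* :- (w′ :* d′) :+ :ι 2 :* (s :* v′) :+ c :* (:ι 2 :* v) :+ d′ :* (s :* w′)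
         :+ c :* w :* d′ :+ :ι 2 :* b :* w :* (a :* α) :+ :- (:ι 2 :* a :* w) :* (b :* β))
       refl x N (V n) (V (suc n)) (W n) (W (suc n)) (D n) (D (suc n)) (g (2+2n n)) (g (suc (2+2n n))))))))))
    where N = ι n

  -- The coefficient of y² in ∏ (1 + ε_j y) is ((Σ ε_j)² - Σ ε_j²)/2 = (D² - 4H²)/8, and U carries
  -- the opposite sign.
  U-closed : ∀ n → Nonvanishing (suc (n ℕ.+ n)) → ι 8 * U n ≈ W n * (ι 4 * H² n - D n * D n)
  U-closed zero nz =
    modulo (*-congˡ { - (ι 4 * W 0)} (H²-suc nz 0 ℕ.≤-refl))
    (modulo (*-congˡ {W 0 * (D 0 - ι 2 * g 1)} (D0 nz))
    (solve 4 (λ a H d γ → let w = a :* :1 :+ :ι 0 in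
       :ι 8 :* (a :* (:1 :* :ι 0) :+ :ι 0) :+ :- (:ι 4 :* w) :* (:ι 0 :+ γ :* γ) :+ w :* (d :- :ι 2 :* γ) :* :- (:ι 2 :* γ)
       := w :* (:ι 4 :* H :- d :* d) :+ :- (:ι 4 :* w) :* H :+ w :* (d :- :ι 2 :* γ) :* d)
       refl (A 0 0) (H² 0) (D 0) (g 1)))
  U-closed (suc n) nz = *-cancelˡ-≉0 (x+2+n≉0 n nz)
    (modulo (*-congˡ {ι 8} (U-suc n (weaken n nz)))
    (modulo (*-congˡ {C n} (U-closed n (weaken n nz)))
    (modulo (*-congˡ {ι 4} (V-closed n (weaken n nz)))
    (modulo (*-congˡ { - (ι 4 * H² (suc n) - D (suc n) * D (suc n))} (W-suc n))
    (modulo (*-congˡ { - (ι 4 * C n * W n)} (H²-suc-suc n nz))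
    (modulo (*-congˡ {C n * W n * (D (suc n) + (D n + ι 2 * α - ι 2 * β))} (D-suc n nz))
    -- The increment of 4H² - D² is 8αβ - 4D(α - β), the squares of α and β having cancelled.
    -- Multiplied by C = ab it becomes 8 - 4D, which matches 8(W + V) since 2V = -WD.
    (modulo (*-congˡ { - (ι 8 * W n * (b * β)) + ι 4 * W n * D n * b} ([x+2+2n]g≈1 n nz))
    (modulo (*-congˡ { - (ι 8 * W n) - ι 4 * W n * D n * a} ([x+3+2n]g≈1 n nz))
    (solve 13 (λ x n u u′ v w w′ d d′ H H′ α β →
       let s = x :+ n :+ :ι 2 ; a = x :+ (n :+ n :+ :ι 2) ; b = x :+ (n :+ n :+ :ι 3) ; c = a :* b
           R = d :+ :ι 2 :* α :- :ι 2 :* β ; Q′ = :ι 4 :* H′ :- d′ :* d′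
           e₁ = :- (:ι 8 :* w :* (b :* β)) :+ :ι 4 :* w :* d :* b
           e₂ = :- (:ι 8 :* w) :- :ι 4 :* w :* d :* a in
       s :* (:ι 8 :* u′) :+ :ι 8 :* (c :* u :+ (w :+ v)) :+ c :* (w :* (:ι 4 :* H :- d :* d))
         :+ :ι 4 :* :- (w :* d) :+ :- Q′ :* (c :* w) :+ :- (:ι 4 :* c :* w) :* (H :+ α :* α :+ β :* β)
         :+ c :* w :* (d′ :+ R) :* R :+ e₁ :* :1 :+ e₂ :* :1
       := s :* (w′ :* Q′) :+ :ι 8 :* (s :* u′) :+ c :* (:ι 8 :* u)
         :+ :ι 4 :* (:ι 2 :* v) :+ :- Q′ :* (s :* w′) :+ :- (:ι 4 :* c :* w) :* H′
         :+ c :* w :* (d′ :+ R) :* d′ :+ e₁ :* (a :* α) :+ e₂ :* (b :* β))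
       refl x N (U n) (U (suc n)) (V n) (W n) (W (suc n)) (D n) (D (suc n)) (H² n) (H² (suc n)) α β)))))))))
    where
    N = ι n
    α = g (2+2n n)
    β = g (suc (2+2n n))
    a = x + (N + N + ι 2)
    b = x + (N + N + ι 3)

  -- From the binomial summand to the coefficients A_k, and the second moment.

  falling-r : ∀ k → falling (x + ι k) k ≈ r k
  falling-r zero    = refl
  falling-r (suc k) = begin
    falling (x + (1# + ι k)) (suc k)  ≈⟨ falling-cong (suc k) 1+x+k ⟩
    falling (1# + (x + ι k)) (suc k)  ≈⟨ falling-top (x + ι k) k ⟩
    (1# + (x + ι k)) * falling (x + ι k) k  ≈⟨ *-cong (sym 1+x+k) (falling-r k) ⟩
    (x + (1# + ι k)) * r k            ∎
    where
    1+x+k : x + (1# + ι k) ≈ 1# + (x + ι k)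
    1+x+k = solve 2 (λ x k → x :+ (:1 :+ k) := :1 :+ (x :+ k)) refl x (ι k)

  -- For k ≤ n the truncated subtraction is a genuine one, so it may be carried out in the field as
  -- in `A`.
  ι[2n∸k] : ∀ n k → k ℕ.≤ n → ι (2 ℕ.* n ∸ k) ≈ ι n + ι n - ι k
  ι[2n∸k] n k k≤n = begin
    ι (2 ℕ.* n ∸ k)                ≈⟨ solve 2 (λ a b → a := a :+ b :- b) refl _ (ι k) ⟩
    ι (2 ℕ.* n ∸ k) + ι k - ι k    ≈⟨ +-congʳ (ι-+ (2 ℕ.* n ∸ k) k) ⟨
    ι (2 ℕ.* n ∸ k ℕ.+ k) - ι k    ≡⟨ ≡.cong (λ m → ι m - ι k) (ℕ.m∸n+n≡m (ℕ.≤-trans k≤n (ℕ.m≤m+n n _))) ⟩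
    ι (2 ℕ.* n) - ι k              ≈⟨ +-congʳ (natCast-* 2 n) ⟩
    ι 2 * ι n - ι k                ≈⟨ solve 2 (λ n k → :ι 2 :* n :- k := n :+ n :- k) refl (ι n) (ι k) ⟩
    ι n + ι n - ι k                ∎

  T : ℕ → Carrier
  T n = Σ₀ n (λ k → ι k * ι k * A n k * h k)

  -- The falling factorial of the first binomial takes over the k! of the second and forms A_k; n!
  -- is left as a factor common to all summands.
  summand : ∀ n k → k ℕ.≤ n →
    binom (ι (2 ℕ.* n ∸ k)) n * binom (x + ι k) k * pow (ι k) 2 * Hˡ 2 k x
    ≈ 1/ n ! * (ι k * ι k * A n k * h k)
  summand n k k≤n = begin
    binom (ι (2 ℕ.* n ∸ k)) n * binom (x + ι k) k * pow (ι k) 2 * Hˡ 2 k x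
      ≈⟨ *-congʳ (*-congʳ (*-cong (*-congʳ (falling-cong n (ι[2n∸k] n k k≤n))) (*-congʳ (falling-r k)))) ⟩
    falling (ι n + ι n - ι k) n * 1/ n ! * (r k * 1/ k !) * pow (ι k) 2 * Hˡ 2 k x
      ≈⟨ solve 6 (λ f c r d k H → f :* c :* (r :* d) :* (k :* (k :* :1)) :* H
                               := c :* (k :* k :* (f :* d) :* (r :* H))) refl _ _ _ _ _ _ ⟩
    1/ n ! * (ι k * ι k * A n k * h k) ∎

  -- Elimination of the first moments leaves U, V and W. With `q` as below, U gets the coefficient
  -- 8n(x+1)(q + (x+1)(x+n+2)), whose last bracket is xn+3n+1; V gets 8(x+n+1)q, and the W terms
  -- collect to 8(x²+3x+n²-n+1).
  T-closed : ∀ n → Nonvanishing (suc (n ℕ.+ n)) →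
    ι 8 * ((x + ι n + ι 2) * ((ι n + x + ι 3) * T n))
    ≈ W n * (ι n * (x + 1#) * (x * ι n + ι 3 * ι n + 1#) * (ι 4 * H² n - D n * D n)
             + ι 8 * (pow x 2 + ι 3 * x + pow (ι n) 2 - ι n + 1#)
             + ι 4 * (x + ι n + 1#) * (pow x 2 + ι 3 * x - ι 2 * ι n + 1#) * D n)
  T-closed n nz =
    modulo (*-congˡ {ι 8 * s} T-rel)
    (modulo (*-congˡ { - ι 8} rM₁-rel)
    (modulo (*-congˡ {ι 8 * q} hM₁-rel)
    (modulo (*-congˡ {N * (x + 1#) * q + N * (x + 1#) * (x + 1#) * s} (U-closed n nz))
    (modulo (*-congˡ {ι 4 * (x + N + 1#) * q} (V-closed n nz))
    (solve 10 (λ x n t m₀ m₁ w u v d H →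
       let s = x :+ n :+ :ι 2 ; q = :ι 2 :* n :- x :* x :- :ι 3 :* x :- :1 ; y = x :+ :1
           e₁ = n :* y :* q :+ n :* y :* y :* s ; e₂ = :ι 4 :* (x :+ n :+ :1) :* q in
       :ι 8 :* (s :* ((n :+ x :+ :ι 3) :* t))
         :+ :ι 8 :* s :* (n :* w :- m₀ :+ q :* m₁ :+ n :* y :* y :* u)
         :+ :- :ι 8 :* (n :* y :* w)
         :+ :ι 8 :* q :* (n :* y :* u :+ ((x :+ n :+ :1) :* v :- w))
         :+ e₁ :* (w :* (:ι 4 :* H :- d :* d))
         :+ e₂ :* :- (w :* d)
       := w :* (n :* y :* (x :* n :+ :ι 3 :* n :+ :1) :* (:ι 4 :* H :- d :* d)
                :+ :ι 8 :* (x :* (x :* :1) :+ :ι 3 :* x :+ n :* (n :* :1) :- n :+ :1)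
                :+ :ι 4 :* (x :+ n :+ :1) :* (x :* (x :* :1) :+ :ι 3 :* x :- :ι 2 :* n :+ :1) :* d)
         :+ :ι 8 :* s :* ((n :+ x :+ :ι 3) :* t)
         :+ :- :ι 8 :* (s :* m₀)
         :+ :ι 8 :* q :* (s :* m₁)
         :+ e₁ :* (:ι 8 :* u)
         :+ e₂ :* (:ι 2 :* v))
       refl x N (T n) rM₁ hM₁ (W n) (U n) (V n) (D n) (H² n))))))
    where
    N = ι n
    s = x + N + ι 2
    q = ι 2 * N - x * x - ι 3 * x - 1#
    rM₁ = Σ₀ n (λ k → ι k * A n k * r k)
    hM₁ = Σ₀ n (λ k → ι k * A n k * h k)

    h-step′ : ∀ k → k ℕ.≤ n → - z k ≈ (x + ι (suc k)) * h k - h (suc k)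
    h-step′ k k≤n = h-step nz k (1+k≤1+2n k≤n)

    rM₁-rel : s * rM₁ ≈ N * (x + 1#) * W n
    rM₁-rel = begin
      s * rM₁
        ≈⟨ Telescoping.M₁-M₀ F x n r (λ _ → 0#) (λ k _ → r-step k) ⟩
      N * (x + 1#) * W n + Σ₀ n (λ k → (ι k - N) * A n k * 0#)
        ≈⟨ +-congˡ (Σ₀-zero n _ (λ _ _ → zeroʳ _)) ⟩
      N * (x + 1#) * W n + 0#
        ≈⟨ +-identityʳ _ ⟩
      N * (x + 1#) * W n ∎

    -- Here n - k = (x+n+1) - (x+k+1), and x+k+1 cancels the denominator of `z`.
    hM₁-rel : s * hM₁ ≈ N * (x + 1#) * U n + ((x + N + 1#) * V n - W n)
    hM₁-rel = begin
      s * hM₁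
        ≈⟨ Telescoping.M₁-M₀ F x n h (λ k → - z k) h-step′ ⟩
      N * (x + 1#) * U n + Σ₀ n (λ k → (ι k - N) * A n k * - z k)
        ≈⟨ +-congˡ (Σ₀-cong n term) ⟩
      N * (x + 1#) * U n + Σ₀ n (λ k → (x + N + 1#) * (A n k * z k) + - 1# * (A n k * r k))
        ≈⟨ +-congˡ (trans (Σ₀-+ n _ _) (+-cong (Σ₀-* n _ _) (Σ₀-* n _ _))) ⟩
      N * (x + 1#) * U n + ((x + N + 1#) * V n + - 1# * W n)
        ≈⟨ +-congˡ (solve 2 (λ a b → a :+ :- :1 :* b := a :- b) refl _ _) ⟩
      N * (x + 1#) * U n + ((x + N + 1#) * V n - W n) ∎
      where
      term : ∀ k → k ℕ.≤ n →
        (ι k - N) * A n k * - z k ≈ (x + N + 1#) * (A n k * z k) + - 1# * (A n k * r k)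
      term k k≤n =
        modulo (*-congˡ { - A n k} ([x+k]z≈r nz k (1+k≤1+2n k≤n)))
        (solve 6 (λ x n k a z r →
           (k :- n) :* a :* :- z :+ :- a :* r
           := (x :+ n :+ :1) :* (a :* z) :+ :- :1 :* (a :* r) :+ :- a :* ((x :+ (:1 :+ k)) :* z))
           refl x N (ι k) (A n k) (z k) (r k))

    T-rel : (N + x + ι 3) * T n ≈ N * W n - rM₁ + q * hM₁ + N * (x + 1#) * (x + 1#) * U n
    T-rel = begin
      (N + x + ι 3) * T n
        ≈⟨ Telescoping.M₂-M₁-M₀ F x n h (λ k → - z k) h-step′ ⟩
      Σ₀ n (λ k → (ι k - N) * A n k * ((x + ι (suc k)) * - z k)) + q * hM₁ + N * (x + 1#) * (x + 1#) * U n
        ≈⟨ +-congʳ (+-congʳ sum) ⟩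
      N * W n - rM₁ + q * hM₁ + N * (x + 1#) * (x + 1#) * U n ∎
      where
      term : ∀ k → k ℕ.≤ n →
        (ι k - N) * A n k * ((x + ι (suc k)) * - z k) ≈ N * (A n k * r k) + - 1# * (ι k * A n k * r k)
      term k k≤n =
        modulo (*-congˡ {(N - ι k) * A n k} ([x+k]z≈r nz k (1+k≤1+2n k≤n)))
        (solve 6 (λ x n k a z r → let s = x :+ (:1 :+ k) in
           (k :- n) :* a :* (s :* :- z) :+ (n :- k) :* a :* r
           := n :* (a :* r) :+ :- :1 :* (k :* a :* r) :+ (n :- k) :* a :* (s :* z))
           refl x N (ι k) (A n k) (z k) (r k))
      sum : Σ₀ n (λ k → (ι k - N) * A n k * ((x + ι (suc k)) * - z k)) ≈ N * W n - rM₁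
      sum = begin
        _ ≈⟨ Σ₀-cong n term ⟩
        _ ≈⟨ Σ₀-+ n _ _ ⟩
        _ ≈⟨ +-cong (Σ₀-* n _ _) (Σ₀-* n _ _) ⟩
        N * W n + - 1# * rM₁ ≈⟨ solve 2 (λ a b → a :+ :- :1 :* b := a :- b) refl _ _ ⟩
        N * W n - rM₁ ∎

  -- y, h₂ and d absorb the indices 2n+1 and n+1 of the theorem, which are only
  -- propositionally equal to those in H² n and D n.
  summation : ∀ m (let n = suc (suc m)) (y h₂ d : Carrier) →
    Nonvanishing (suc (n ℕ.+ n)) →
    y ≈ x + (1# + (ι n + ι n)) → h₂ ≈ H² n → d ≈ D n →
    ¬ ((ι n * (x + 1#) * (x * ι n + ι 3 * ι n + 1#)) ≈ 0#) →
    Σ₀ n (λ k → binom (ι (2 ℕ.* n ∸ k)) n * binom (x + ι k) k * pow (ι k) 2 * Hˡ 2 k x)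
    ≈
    ((x + 1#) * (x * ι n + ι 3 * ι n + 1#)) / (ι 8 * (ι n - 1#))
      * binom y m
      * ( ι 4 * h₂
          + (ι 8 * (pow x 2 + ι 3 * x + pow (ι n) 2 - ι n + 1#))
              / (ι n * (x + 1#) * (x * ι n + ι 3 * ι n + 1#))
          - d
            * ( d
                - (ι 4 * (x + ι n + 1#) * (pow x 2 + ι 3 * x - ι 2 * ι n + 1#))
                    / (ι n * (x + 1#) * (x * ι n + ι 3 * ι n + 1#)) ) )
  summation m y h₂ d nz y≈ h₂≈ d≈ Δ≉0 = begin
    Σ₀ n (λ k → binom (ι (2 ℕ.* n ∸ k)) n * binom (x + ι k) k * pow (ι k) 2 * Hˡ 2 k x)
      ≈⟨ Σ₀-cong n (summand n) ⟩
    Σ₀ n (λ k → 1/ n ! * (ι k * ι k * A n k * h k))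
      ≈⟨ Σ₀-* n _ _ ⟩
    1/ n ! * T n
      ≈⟨ *-cancelˡ-≉0 (char0 7) 8T ⟩
    _ ∎
    where
    n = suc (suc m)
    N = ι n
    f = falling y m
    c₂ = 1/ n !
    Δ = N * (x + 1#) * (x * N + ι 3 * N + 1#)
    i = (ι 8 * (N - 1#)) ⁻¹
    a = pow x 2 + ι 3 * x + pow N 2 - N + 1#
    b = (x + N + 1#) * (pow x 2 + ι 3 * x - ι 2 * N + 1#)

    -- The two smallest factors of W are the multipliers on the left of `T-closed`; cancelling them
    -- shortens the falling factorial from n to n - 2 factors.
    W-factor : W n ≈ f * (N + x + ι 3) * (x + N + ι 2)
    W-factor = begin
      W n
        ≈⟨ W-closed n nz ⟩
      falling y₀ m * (y₀ - ι m) * (y₀ - ι (suc m))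
        ≈⟨ *-congʳ (*-congʳ (falling-cong m (sym y≈))) ⟩
      f * (y₀ - ι m) * (y₀ - ι (suc m))
        ≈⟨ solve 3 (λ x m f → let n = :1 :+ (:1 :+ m) ; y = x :+ (:1 :+ (n :+ n)) in
             f :* (y :- m) :* (y :- (:1 :+ m)) := f :* (n :+ x :+ :ι 3) :* (x :+ n :+ :ι 2)) refl x (ι m) f ⟩
      f * (N + x + ι 3) * (x + N + ι 2) ∎
      where y₀ = x + (1# + (N + N))

    s₂≉0 : ¬ (x + N + ι 2 ≈ 0#)
    s₂≉0 eq = nz (suc (suc n)) (ℕ.s≤s ℕ.z≤n) (ℕ.s≤s (ℕ.+-monoˡ-≤ n {1} {n} (ℕ.s≤s ℕ.z≤n)))
      (trans (solve 2 (λ x n → x :+ (:1 :+ (:1 :+ n)) := x :+ n :+ :ι 2) refl x N) eq)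

    -- It is n ≥ 2 that puts the index n + 3 within the range up to 2n + 1.
    s₃≉0 : ¬ (N + x + ι 3 ≈ 0#)
    s₃≉0 eq = nz (suc (suc (suc n))) (ℕ.s≤s ℕ.z≤n) (ℕ.s≤s (ℕ.+-monoˡ-≤ n {2} {n} (ℕ.s≤s (ℕ.s≤s ℕ.z≤n))))
      (trans (solve 2 (λ x n → x :+ (:1 :+ (:1 :+ (:1 :+ n))) := n :+ x :+ :ι 3) refl x N) eq)

    8T≈fX : ι 8 * T n ≈ f * (Δ * (ι 4 * h₂ - d * d) + ι 8 * a + ι 4 * b * d)
    8T≈fX = *-cancelˡ-≉0 (*-≉0 s₂≉0 s₃≉0) (begin
      (x + N + ι 2) * (N + x + ι 3) * (ι 8 * T n)
        ≈⟨ solve 4 (λ s t e u → s :* t :* (e :* u) := e :* (s :* (t :* u))) refl _ _ _ _ ⟩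
      ι 8 * ((x + N + ι 2) * ((N + x + ι 3) * T n))
        ≈⟨ T-closed n nz ⟩
      W n * (Δ * (ι 4 * H² n - D n * D n) + ι 8 * a
             + ι 4 * (x + N + 1#) * (pow x 2 + ι 3 * x - ι 2 * N + 1#) * D n)
        ≈⟨ *-cong W-factor (+-cong (+-congʳ (*-congˡ (+-cong (*-congˡ (sym h₂≈)) (-‿cong (*-cong (sym d≈) (sym d≈)))))) (*-congˡ (sym d≈))) ⟩
      f * (N + x + ι 3) * (x + N + ι 2) * (Δ * (ι 4 * h₂ - d * d) + ι 8 * a
             + ι 4 * (x + N + 1#) * (pow x 2 + ι 3 * x - ι 2 * N + 1#) * d)
        ≈⟨ solve 8 (λ f s t X Y u v d →
             f :* s :* t :* (X :+ Y :+ :ι 4 :* u :* v :* d)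
             := t :* s :* (f :* (X :+ Y :+ :ι 4 :* (u :* v) :* d))) refl _ _ _ _ _ _ _ _ ⟩
      (x + N + ι 2) * (N + x + ι 3) * (f * (Δ * (ι 4 * h₂ - d * d) + ι 8 * a + ι 4 * b * d)) ∎)

    -- Of the two factors between 1/n! and 1/(n-2)!, n - 1 cancels against the prefactor and n
    -- completes (x+1)(xn+3n+1) to `Δ`.
    1/m! : 1/ m ! ≈ (N - 1#) * (N * c₂)
    1/m! = begin
      1/ m !                          ≈⟨ 1/!-suc m ⟩
      ι (suc m) * 1/ suc m !          ≈⟨ *-cong (solve 1 (λ a → a := :1 :+ a :- :1) refl _) (1/!-suc (suc m)) ⟩
      (N - 1#) * (N * c₂)             ∎

    8[n-1]≉0 : ¬ (ι 8 * (N - 1#) ≈ 0#)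
    8[n-1]≉0 = *-≉0 (char0 7) λ eq → char0 m (trans (solve 1 (λ a → a := :1 :+ a :- :1) refl _) eq)

    8T : ι 8 * (c₂ * T n) ≈ ι 8 *
      (((x + 1#) * (x * N + ι 3 * N + 1#)) * i * (f * 1/ m !)
        * (ι 4 * h₂ + ι 8 * a * Δ ⁻¹
           - d * (d - ι 4 * (x + N + 1#) * (pow x 2 + ι 3 * x - ι 2 * N + 1#) * Δ ⁻¹)))
    8T =
      modulo (*-congˡ {c₂} 8T≈fX)
      (modulo (*-congˡ { - (ι 8 * (P * i * f * S))} 1/m!)
      (modulo (*-congˡ { - (P * f * N * c₂ * S)} (inverseʳ _ 8[n-1]≉0))
      (modulo (*-congˡ { - (f * c₂ * (ι 8 * a + ι 4 * b * d))} (inverseʳ _ Δ≉0))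
      (solve 14 (λ y p n c t f i j k a u v h d →
         let P = y :* p ; Δ = n :* y :* p
             S = :ι 4 :* h :+ :ι 8 :* a :* j :- d :* (d :- :ι 4 :* u :* v :* j)
             Y = :ι 8 :* a :+ :ι 4 :* (u :* v) :* d
             X = Δ :* (:ι 4 :* h :- d :* d) :+ :ι 8 :* a :+ :ι 4 :* (u :* v) :* d in
         :ι 8 :* (c :* t) :+ c :* (f :* X) :+ :- (:ι 8 :* (P :* i :* f :* S)) :* ((n :- :1) :* (n :* c))
           :+ :- (P :* f :* n :* c :* S) :* :1 :+ :- (f :* c :* Y) :* :1
         := :ι 8 :* (P :* i :* (f :* k) :* S) :+ c :* (:ι 8 :* t) :+ :- (:ι 8 :* (P :* i :* f :* S)) :* k
           :+ :- (P :* f :* n :* c :* S) :* (:ι 8 :* (n :- :1) :* i) :+ :- (f :* c :* Y) :* (Δ :* j))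
         refl (x + 1#) (x * N + ι 3 * N + 1#) N c₂ (T n) f i (Δ ⁻¹) (1/ m !) a
           (x + N + 1#) (pow x 2 + ι 3 * x - ι 2 * N + 1#) h₂ d))))
      where
      P = (x + 1#) * (x * N + ι 3 * N + 1#)
      S = ι 4 * h₂ + ι 8 * a * Δ ⁻¹ - d * (d - ι 4 * (x + N + 1#) * (pow x 2 + ι 3 * x - ι 2 * N + 1#) * Δ ⁻¹)

-- The summation formula with its indices in the original form.

theorem6 : ∀ {c ℓ} (F : Char0Field c ℓ) → let open Char0Field F in let open FieldOps F in
    (x : Carrier) (n : ℕ) → 2 ℕ.≤ n →
    (∀ k → 1 ℕ.≤ k → k ℕ.≤ 2 ℕ.* n ℕ.+ 1 → ¬ ((x + ι k) ≈ 0#)) →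
    (∀ k → 1 ℕ.≤ k → k ℕ.≤ n → ¬ ((x / ι 2 + ι k) ≈ 0#)) →
    (∀ k → 1 ℕ.≤ k → k ℕ.≤ n ℕ.+ 1 → ¬ (((x - 1#) / ι 2 + ι k) ≈ 0#)) →
    ¬ ((ι n * (x + 1#) * (x * ι n + ι 3 * ι n + 1#)) ≈ 0#) →
    Σ₀ n (λ k → binom (ι (2 ℕ.* n ∸ k)) n * binom (x + ι k) k * pow (ι k) 2 * Hˡ 2 k x)
    ≈
    ((x + 1#) * (x * ι n + ι 3 * ι n + 1#)) / (ι 8 * (ι n - 1#))
      * binom (x + ι (2 ℕ.* n ℕ.+ 1)) (n ∸ 2)
      * ( ι 4 * Hˡ 2 (2 ℕ.* n ℕ.+ 1) x
          + (ι 8 * (pow x 2 + ι 3 * x + pow (ι n) 2 - ι n + 1#))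
              / (ι n * (x + 1#) * (x * ι n + ι 3 * ι n + 1#))
          - (H n (x / ι 2) - H (n ℕ.+ 1) ((x - 1#) / ι 2))
            * ( H n (x / ι 2) - H (n ℕ.+ 1) ((x - 1#) / ι 2)
                - (ι 4 * (x + ι n + 1#) * (pow x 2 + ι 3 * x - ι 2 * ι n + 1#))
                    / (ι n * (x + 1#) * (x * ι n + ι 3 * ι n + 1#)) ) )
-- Matching on 2 ≤ n exposes n = m + 2, which makes `n ∸ 2` reduce to m.
theorem6 F x n@(suc (suc m)) (ℕ.s≤s (ℕ.s≤s ℕ.z≤n)) nz _ _ Δ≉0 =
  summation m _ _ _ (≡.subst Nonvanishing 2n+1≡ nz)
    (trans (reflexive (≡.cong (λ k → x + ι k) 2n+1≡)) (+-congˡ (+-congˡ (ι-double n))))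
    (reflexive (≡.cong (λ k → Hˡ 2 k x) 2n+1≡))
    (reflexive (≡.cong (λ k → H n (x / ι 2) - H k ((x - 1#) / ι 2)) (ℕ.+-comm n 1)))
    Δ≉0
  where
  open Char0Field F
  open FieldOps F
  open ClosedForms F x
  2n+1≡ : 2 ℕ.* n ℕ.+ 1 ≡ suc (n ℕ.+ n)
  2n+1≡ = ≡.trans (ℕ.+-comm (2 ℕ.* n) 1) (≡.cong (λ k → suc (n ℕ.+ k)) (ℕ.+-identityʳ n))
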